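{- If $T$ is a tree of order $n \ge 2$ with no strong support vertex, then $\gamma_{\rm gr}^t(T) \ge \frac{2}{3}(n+1)$, with equality if and only if $T \in \mathcal{T}$.
   Context: A leaf is a vertex of degree $1$, a support vertex is a vertex adjacent to a leaf, and a strong support vertex is a vertex adjacent to at least two leaves. Operation $\mathcal{O}_1$: given a tree $T'$ and a support vertex $v$ of $T'$, add a new path $v_1v_2v_3$ (three new vertices) and the edge $vv_1$. The family $\mathcal{T}$ is the smallest family of trees containing the path $P_2$ and closed under operation $\mathcal{O}_1$. $N(v)$ denotes the open neighborhood of $v$. A sequence $S=(v_1,\ldots,v_k)$ of distinct vertices of a graph $G$ without isolated vertices is a legal sequence if $N(v_i)\setminus \bigcup_{j=1}^{i-1} N(v_j)\neq\emptyset$ for every $i\in\{2,\ldots,k\}$, and a total dominating sequence if moreover $\{v_1,\ldots,v_k\}$ is a total dominating set of $G$. $\gamma_{\rm gr}^t(G)$ is the maximum length of a total dominating sequence of $G$. -}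

module Defs where

open import Data.Bool.Base using (Bool; true; false; not; T)
open import Data.Bool.Properties using (T?)
open import Data.Fin.Base as Fin using (Fin; zero; suc; inject₁; fromℕ; toℕ)
open import Data.Fin.Properties as Fin using (any?; all?)
open import Data.Nat.Base as ℕ using (ℕ; zero; suc; _+_; _≤_; _<_; z≤n)
import Data.Nat.Properties as ℕ
open import Data.Product.Base using (∃; _×_; _,_)
open import Data.Vec.Base using (Vec; []; _∷_; lookup; count; allFin)
open import Data.Vec.Membership.Propositional using (_∈_)
import Data.Vec.Membership.DecPropositional as DecMembership
open import Data.Vec.Relation.Unary.AllPairs using (allPairs?)
open import Data.Vec.Relation.Unary.Unique.Propositional using (Unique)
open import Data.Vec.Relation.Unary.Unique.Propositional.Properties using (lookup-injective)
open import Function.Bundles using (_↔_; Inverse)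
open import Function.Definitions using (Injective)
open import Level using (Level; 0ℓ)
open import Relation.Binary.Construct.Closure.ReflexiveTransitive using (Star)
open import Relation.Binary.PropositionalEquality using (_≡_; _≢_; refl)
open import Relation.Nullary.Decidable
  using (Dec; yes; no; does; map′; ¬?; _×-dec_; _→-dec_)
open import Relation.Nullary.Negation using (¬_)
open import Relation.Unary using (Pred; Decidable)

-- Finite simple graphs of order n.

record Graph (n : ℕ) : Set where
  field
    adj    : Fin n → Fin n → Bool
    sym    : ∀ u v → adj u v ≡ adj v u
    irrefl : ∀ v → adj v v ≡ false

  infix 4 _~_ _~?_

  _~_ : Fin n → Fin n → Set
  u ~ v = T (adj u v)

  _~?_ : ∀ u v → Dec (u ~ v)
  u ~? v = T? (adj u v)

record _≅_ {m n : ℕ} (G : Graph m) (H : Graph n) : Set where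
  field
    bijection : Fin m ↔ Fin n
    adj-≡     : ∀ u v → Graph.adj G u v
                      ≡ Graph.adj H (Inverse.to bijection u) (Inverse.to bijection v)

module _ {n : ℕ} (G : Graph n) where
  open Graph G

  Connected : Set
  Connected = ∀ u v → Star _~_ u v

  -- A cycle c₀ ~ c₁ ~ … ~ c₂₊ₖ ~ c₀ on 3 + k distinct vertices.
  record Cycle : Set where
    field
      {k}       : ℕ
      vertex    : Fin (3 + k) → Fin n
      injective : Injective _≡_ _≡_ vertex
      step      : ∀ (i : Fin (2 + k)) → vertex (inject₁ i) ~ vertex (suc i)
      closing   : vertex (fromℕ (2 + k)) ~ vertex zero

  IsTree : Set
  IsTree = Connected × ¬ Cycle

  degree : Fin n → ℕ
  degree v = count (v ~?_) (allFin n)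

  Leaf : Fin n → Set
  Leaf v = degree v ≡ 1

  Support : Fin n → Set
  Support v = ∃ λ l → v ~ l × Leaf l

  StrongSupport : Fin n → Set
  StrongSupport v = ∃ λ l → ∃ λ l′ → l ≢ l′ × (v ~ l × Leaf l) × (v ~ l′ × Leaf l′)

  TotalDominating : Pred (Fin n) 0ℓ → Set
  TotalDominating D = ∀ u → ∃ λ w → D w × u ~ w

  -- The first vertex is exempt from the condition on neighborhoods; w is a
  -- vertex of N(vᵢ) lying in no N(vⱼ) with j < i.
  Legal : ∀ {k} → Vec (Fin n) k → Set
  Legal {k} S = Unique S ×
    (∀ (i : Fin k) → 0 < toℕ i →
      ∃ λ w → lookup S i ~ w × (∀ j → j Fin.< i → ¬ lookup S j ~ w))

  TotalDominatingSequence : ∀ {k} → Vec (Fin n) k → Set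
  TotalDominatingSequence S = Legal S × TotalDominating (_∈ S)

  HasTDSequence : ℕ → Set
  HasTDSequence k = ∃ λ (S : Vec (Fin n) k) → TotalDominatingSequence S

  legal? : ∀ {k} → Decidable (Legal {k})
  legal? S = allPairs? (λ u v → ¬? (u Fin.≟ v)) S ×-dec
    all? λ i → (0 ℕ.<? toℕ i) →-dec
      any? λ w → (lookup S i ~? w) ×-dec
        all? λ j → (j Fin.<? i) →-dec ¬? (lookup S j ~? w)

  tdSequence? : ∀ {k} → Decidable (TotalDominatingSequence {k})
  tdSequence? S = legal? S ×-dec all? λ u → any? λ w → (w ∈? S) ×-dec (u ~? w)
    where open DecMembership Fin._≟_ using (_∈?_)

anyVec? : ∀ {n k} {p : Level} {P : Pred (Vec (Fin n) k) p} → Decidable P → Dec (∃ P)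
anyVec? {k = zero}  P? = map′ ([] ,_) (λ { ([] , p) → p }) (P? [])
anyVec? {k = suc k} P? =
  map′ (λ { (x , xs , p) → x ∷ xs , p }) (λ { (x ∷ xs , p) → x , xs , p })
       (any? λ x → anyVec? λ xs → P? (x ∷ xs))

-- The largest k ≤ b satisfying P, or 0 if there is none.
largest : ∀ {P : Pred ℕ 0ℓ} → Decidable P → ℕ → ℕ
largest P? zero    = zero
largest P? (suc b) with P? (suc b)
... | yes _ = suc b
... | no  _ = largest P? b

largest-satisfies : ∀ {P : Pred ℕ 0ℓ} (P? : Decidable P) b {k} →
                    k ≤ b → P k → P (largest P? b)
largest-satisfies P? zero    z≤n p = p
largest-satisfies P? (suc b) k≤  p with P? (suc b)
... | yes q = q
... | no ¬q = largest-satisfies P? b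
                (ℕ.≤-pred (ℕ.≤∧≢⇒< k≤ λ { refl → ¬q p })) p

largest-upper : ∀ {P : Pred ℕ 0ℓ} (P? : Decidable P) b {k} →
                k ≤ b → P k → k ≤ largest P? b
largest-upper P? zero    z≤n p = z≤n
largest-upper P? (suc b) k≤  p with P? (suc b)
... | yes _ = k≤
... | no ¬q = largest-upper P? b
                (ℕ.≤-pred (ℕ.≤∧≢⇒< k≤ λ { refl → ¬q p })) p

-- The Grundy total domination number.  The search may stop at n because the
-- vertices of a sequence are distinct; γgrᵗ-attained and γgrᵗ-maximum show that
-- it is the maximum length whenever a total dominating sequence exists.
γgrᵗ : ∀ {n} → Graph n → ℕ
γgrᵗ {n} G = largest {P = HasTDSequence G} (λ k → anyVec? (tdSequence? G)) n

module _ {n : ℕ} (G : Graph n) where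

  length≤order : ∀ {k} → HasTDSequence G k → k ≤ n
  length≤order (S , (unique , _) , _) =
    Fin.injective⇒≤ {f = lookup S} (lookup-injective unique _ _)

  γgrᵗ-attained : ∀ {k} → HasTDSequence G k → HasTDSequence G (γgrᵗ G)
  γgrᵗ-attained s = largest-satisfies _ n (length≤order s) s

  γgrᵗ-maximum : ∀ {k} → HasTDSequence G k → k ≤ γgrᵗ G
  γgrᵗ-maximum s = largest-upper _ n (length≤order s) s

P₂ : Graph 2
P₂ = record
  { adj    = adj
  ; sym    = λ { zero zero → refl ; zero (suc zero) → refl
               ; (suc zero) zero → refl ; (suc zero) (suc zero) → refl }
  ; irrefl = λ { zero → refl ; (suc zero) → refl }
  }
  where
  adj : Fin 2 → Fin 2 → Bool
  adj u v = not (does (u Fin.≟ v))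

pattern v₁ = zero
pattern v₂ = suc zero
pattern v₃ = suc (suc zero)
pattern old u = suc (suc (suc u))

-- The underlying construction of operation 𝒪₁: the path v₁v₂v₃ on three new
-- vertices is joined to the vertex v of G by the edge vv₁; old u is the copy
-- of the vertex u of G.
attachP₃ : ∀ {n} → Graph n → Fin n → Graph (3 + n)
attachP₃ {n} G v = record { adj = adj′ ; sym = sym′ ; irrefl = irrefl′ }
  where
  open Graph G

  adj′ : Fin (3 + n) → Fin (3 + n) → Bool
  adj′ v₁      v₂      = true
  adj′ v₂      v₁      = true
  adj′ v₂      v₃      = true
  adj′ v₃      v₂      = true
  adj′ v₁      (old u) = does (u Fin.≟ v)
  adj′ (old u) v₁      = does (u Fin.≟ v)
  adj′ (old u) (old w) = adj u w
  adj′ _       _       = false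

  sym′ : ∀ x y → adj′ x y ≡ adj′ y x
  sym′ v₁      v₁      = refl
  sym′ v₁      v₂      = refl
  sym′ v₁      v₃      = refl
  sym′ v₁      (old _) = refl
  sym′ v₂      v₁      = refl
  sym′ v₂      v₂      = refl
  sym′ v₂      v₃      = refl
  sym′ v₂      (old _) = refl
  sym′ v₃      v₁      = refl
  sym′ v₃      v₂      = refl
  sym′ v₃      v₃      = refl
  sym′ v₃      (old _) = refl
  sym′ (old _) v₁      = refl
  sym′ (old _) v₂      = refl
  sym′ (old _) v₃      = refl
  sym′ (old u) (old w) = sym u w

  irrefl′ : ∀ x → adj′ x x ≡ false
  irrefl′ v₁      = refl
  irrefl′ v₂      = refl
  irrefl′ v₃      = refl
  irrefl′ (old u) = irrefl u

-- Membership in the family 𝒯, whose members are taken up to isomorphism.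
data 𝒯 : ∀ {n} → Graph n → Set where
  path₂ : 𝒯 P₂
  𝒪₁    : ∀ {n} {T′ : Graph n} {v : Fin n} →
          𝒯 T′ → Support T′ v → 𝒯 (attachP₃ T′ v)
  iso   : ∀ {m n} {G : Graph m} {H : Graph n} → G ≅ H → 𝒯 G → 𝒯 H

{-# OPTIONS --safe #-}

-- A tree of order n ≥ 3 without strong support vertices has a leaf l whose
-- neighbour s has degree two, say N(s) = {l, x}: look at the end of a longest
-- path.  For an induced subgraph H avoiding l and s, a sequence S of H extends to
-- l, S, s, so the length grows by two.  If T − {l, s} has no strong support
-- vertex, induction on it gives a strict inequality.  Otherwise x has become a
-- leaf attached to a support vertex y, the graph T − {l, s, x} satisfies the
-- hypotheses, and T arises from it by 𝒪₁ at y, so that equality is inherited.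
--
-- Conversely, a member of 𝒯 of order n has a vertex cover C with 3|C| = n + 1.
-- Each vertex of a sequence or its footprint lies in C, and both the vertices and
-- the footprints are distinct, so the length is at most 2|C|.

module Submission where

open import Defs
open import Data.Bool.Base using (Bool; true; false; T)
open import Data.Bool.Properties using (T?)
open import Data.Empty using (⊥-elim)
open import Data.Fin.Base as Fin
  using (Fin; zero; suc; toℕ; fromℕ; inject₁; punchIn; punchOut; splitAt; join)
open import Data.Fin.Permutation using (↔⇒≡)
open import Data.Fin.Properties as Fin using (any?)
open import Data.Fin.Relation.Unary.Top using (view; view-fromℕ; view-inject₁; ‵fromℕ; ‵inject₁)
open import Data.Nat.Base as ℕ
  using (ℕ; zero; suc; _+_; _*_; _≤_; _≥_; _<_; _>_; z≤n; s≤s)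
import Data.Nat.Properties as ℕ
open import Data.Nat.Tactic.RingSolver using (solve-∀)
open import Data.Product.Base using (∃; ∃₂; _×_; _,_; proj₁; proj₂)
open import Data.Sum.Base as Sum using (_⊎_; inj₁; inj₂; [_,_]′)
open import Data.Vec.Base using (lookup; tabulate; count)
open import Data.Vec.Membership.Propositional.Properties using (∈-tabulate⁺)
open import Data.Vec.Properties using (lookup∘tabulate)
open import Data.Vec.Relation.Unary.Unique.Propositional.Properties using (tabulate⁺; lookup-injective)
open import Function.Base using (_∘_; id)
open import Function.Bundles using (_⇔_; mk⇔; Inverse; mk↔ₛ′)
open import Relation.Binary.Construct.Closure.ReflexiveTransitive using (Star; ε; _◅_)
open import Relation.Binary.Definitions using (tri<; tri≈; tri>)
open import Relation.Binary.PropositionalEquality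
  using (_≡_; _≢_; refl; sym; trans; cong; subst; subst₂)
open import Relation.Nullary.Decidable using (Dec; yes; no; ¬?; _×-dec_; _⊎-dec_; does)
open import Relation.Nullary.Negation using (¬_; contradiction)
open import Relation.Unary using (Decidable)

private
  variable
    m n k : ℕ

-- Adjacency and leaves

infix 4 _⊢_~_

_⊢_~_ : Graph n → Fin n → Fin n → Set
G ⊢ u ~ v = Graph._~_ G u v

~-sym : (G : Graph n) {u v : Fin n} → G ⊢ u ~ v → G ⊢ v ~ u
~-sym G {u} {v} = subst T (Graph.sym G u v)

~-irrefl : (G : Graph n) {v : Fin n} → ¬ G ⊢ v ~ v
~-irrefl G {v} = subst T (Graph.irrefl G v)

~⇒≢ : (G : Graph n) {u v : Fin n} → G ⊢ u ~ v → u ≢ v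
~⇒≢ G u~v refl = ~-irrefl G u~v

T-ext : {a b : Bool} → (T a → T b) → (T b → T a) → a ≡ b
T-ext {false} {false} f g = refl
T-ext {false} {true}  f g = ⊥-elim (g _)
T-ext {true}  {false} f g = ⊥-elim (f _)
T-ext {true}  {true}  f g = refl

does⇒ : {P : Set} (P? : Dec P) → T (does P?) → P
does⇒ (yes p) _ = p

⇒does : {P : Set} (P? : Dec P) → P → T (does P?)
⇒does (yes _) _ = _
⇒does (no ¬p) p = ¬p p

-- A leaf `l` together with its support vertex `s`. This form replaces the degree count of `Leaf`,
-- which is awkward to carry through embeddings and isomorphisms.
record Pendant (G : Graph n) (l s : Fin n) : Set where
  constructor pendant
  field
    edge : G ⊢ l ~ s
    only : ∀ {w} → G ⊢ l ~ w → w ≡ s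

module _ {A : Set} {P : A → Set} (P? : Decidable P) where

  count≡0⇒none : (f : Fin n → A) → count P? (tabulate f) ≡ 0 → ∀ i → ¬ P (f i)
  count≡0⇒none {suc n} f c i p with P? (f zero)
  count≡0⇒none {suc n} f c zero    p | no ¬q = ¬q p
  count≡0⇒none {suc n} f c (suc i) p | no ¬q = count≡0⇒none (f ∘ suc) c i p

  none⇒count≡0 : (f : Fin n → A) → (∀ i → ¬ P (f i)) → count P? (tabulate f) ≡ 0
  none⇒count≡0 {zero}  f none = refl
  none⇒count≡0 {suc n} f none with P? (f zero)
  ... | yes p = contradiction p (none zero)
  ... | no  _ = none⇒count≡0 (f ∘ suc) (none ∘ suc)

  count≡1⇒unique : (f : Fin n → A) → count P? (tabulate f) ≡ 1 →
                   ∃ λ i → P (f i) × (∀ {j} → P (f j) → j ≡ i)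
  count≡1⇒unique {suc n} f c with P? (f zero)
  ... | yes p = zero , p , λ
    { {zero}  _ → refl
    ; {suc j} q → contradiction q (count≡0⇒none (f ∘ suc) (ℕ.suc-injective c) j)
    }
  ... | no ¬p with count≡1⇒unique (f ∘ suc) c
  ... | i , p , unique = suc i , p , λ
    { {zero}  q → contradiction q ¬p
    ; {suc j} q → cong suc (unique q)
    }

  unique⇒count≡1 : (f : Fin n → A) (i : Fin n) → P (f i) → (∀ {j} → P (f j) → j ≡ i) →
                   count P? (tabulate f) ≡ 1
  unique⇒count≡1 f zero p unique with P? (f zero)
  ... | yes _ = cong suc (none⇒count≡0 (f ∘ suc) λ j q → contradiction (unique q) λ ())
  ... | no ¬p = contradiction p ¬p
  unique⇒count≡1 f (suc i) p unique with P? (f zero)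
  ... | yes q = contradiction (unique q) λ ()
  ... | no  _ = unique⇒count≡1 (f ∘ suc) i p (Fin.suc-injective ∘ unique)

leaf⇒pendant : (G : Graph n) {v : Fin n} → Leaf G v → ∃ (Pendant G v)
leaf⇒pendant G {v} leaf with count≡1⇒unique (Graph._~?_ G v) id leaf
... | u , v~u , unique = u , pendant v~u unique

pendant⇒leaf : (G : Graph n) {l s : Fin n} → Pendant G l s → Leaf G l
pendant⇒leaf G {l} (pendant e o) = unique⇒count≡1 (Graph._~?_ G l) id _ e o

leaf-pendant : (G : Graph n) {l s : Fin n} → Leaf G l → G ⊢ l ~ s → Pendant G l s
leaf-pendant G leaf l~s with leaf⇒pendant G leaf
... | u , pendant e o with refl ← o l~s = pendant e o

leaf? : (G : Graph n) → Decidable (Leaf G)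
leaf? G v = degree G v ℕ.≟ 1

¬leaf⇒second-neighbor : (G : Graph n) {u v : Fin n} → G ⊢ v ~ u → ¬ Leaf G v →
                        ∃ λ w → G ⊢ v ~ w × w ≢ u
¬leaf⇒second-neighbor G {u} {v} v~u ¬leaf
  with any? (λ w → T? (Graph.adj G v w) ×-dec ¬? (w Fin.≟ u))
... | yes found = found
... | no ¬found = contradiction (pendant⇒leaf G (pendant v~u only)) ¬leaf
  where
  only : ∀ {w} → G ⊢ v ~ w → w ≡ u
  only {w} v~w with w Fin.≟ u
  ... | yes w≡u = w≡u
  ... | no  w≢u = contradiction (w , v~w , w≢u) ¬found

NoStrongSupport : Graph n → Set
NoStrongSupport G = ∀ v → ¬ StrongSupport G v

strongSupport? : (G : Graph n) → Decidable (StrongSupport G)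
strongSupport? G v = any? λ l → any? λ l′ →
  ¬? (l Fin.≟ l′) ×-dec (support? l ×-dec support? l′)
  where
  support? : ∀ l → Dec (G ⊢ v ~ l × Leaf G l)
  support? l = T? (Graph.adj G v l) ×-dec leaf? G l

-- The form in which the absence of strong support vertices is applied.
twin-leaves : (G : Graph n) → NoStrongSupport G → {l l′ s : Fin n} →
              Pendant G l s → Pendant G l′ s → l ≡ l′
twin-leaves G nss {l} {l′} {s} p p′ with l Fin.≟ l′
... | yes l≡l′ = l≡l′
... | no  l≢l′ = contradiction
  (l , l′ , l≢l′ , (~-sym G (Pendant.edge p) , pendant⇒leaf G p)
                 , (~-sym G (Pendant.edge p′) , pendant⇒leaf G p′)) (nss s)

-- Induced subgraphs

record _↪_ (H : Graph m) (G : Graph n) : Set where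
  field
    to        : Fin m → Fin n
    injective : ∀ {u v} → to u ≡ to v → u ≡ v
    adj-≡     : ∀ u v → Graph.adj H u v ≡ Graph.adj G (to u) (to v)

  preserve : ∀ {u v} → H ⊢ u ~ v → G ⊢ to u ~ to v
  preserve {u} {v} = subst T (adj-≡ u v)

  reflect : ∀ {u v} → G ⊢ to u ~ to v → H ⊢ u ~ v
  reflect {u} {v} = subst T (sym (adj-≡ u v))

  Image : Fin n → Set
  Image w = ∃ λ u → to u ≡ w

  pendant-restrict : ∀ {l s} → Pendant G (to l) (to s) → Pendant H l s
  pendant-restrict (pendant e o) = pendant (reflect e) λ l~w → injective (o (preserve l~w))

  -- A leaf of `H` can acquire further neighbours in `G`, but only outside the image; `inside`
  -- excludes these.
  pendant-extend : ∀ {l s} → (∀ {w} → G ⊢ to l ~ w → Image w) →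
                   Pendant H l s → Pendant G (to l) (to s)
  pendant-extend {l} {s} inside (pendant e o) = pendant (preserve e) only
    where
    only : ∀ {w} → G ⊢ to l ~ w → w ≡ to s
    only l~w with inside l~w
    ... | u , refl = cong to (o (reflect l~w))

  acyclic : ¬ Cycle G → ¬ Cycle H
  acyclic ¬cycle c = ¬cycle record
    { vertex    = to ∘ vertex
    ; injective = λ eq → Cycle.injective c (injective eq)
    ; step      = λ i → preserve (step i)
    ; closing   = preserve closing
    }
    where open Cycle c using (vertex; step; closing)

_∘↪_ : {k m n : ℕ} {K : Graph k} {H : Graph m} {G : Graph n} → H ↪ G → K ↪ H → K ↪ G
e ∘↪ d = record
  { to        = E.to ∘ D.to
  ; injective = D.injective ∘ E.injective
  ; adj-≡     = λ u v → trans (D.adj-≡ u v) (E.adj-≡ _ _)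
  }
  where
  module E = _↪_ e
  module D = _↪_ d

delete : Graph (suc n) → Fin (suc n) → Graph n
delete G l = record
  { adj    = λ u v → Graph.adj G (punchIn l u) (punchIn l v)
  ; sym    = λ u v → Graph.sym G (punchIn l u) (punchIn l v)
  ; irrefl = λ v → Graph.irrefl G (punchIn l v)
  }

delete-↪ : (G : Graph (suc n)) (l : Fin (suc n)) → delete G l ↪ G
delete-↪ G l = record
  { to        = punchIn l
  ; injective = Fin.punchIn-injective l _ _
  ; adj-≡     = λ _ _ → refl
  }

punchIn-cases : (l w : Fin (suc n)) → w ≡ l ⊎ ∃ λ u → punchIn l u ≡ w
punchIn-cases l w with l Fin.≟ w
... | yes l≡w = inj₁ (sym l≡w)
... | no  l≢w = inj₂ (punchOut l≢w , Fin.punchIn-punchOut l≢w)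

-- A walk visits a leaf only as s, l, s; such a detour is cut out.
delete-walk : (G : Graph (suc n)) {l s : Fin (suc n)} → Pendant G l s →
              ∀ {x y} → Star (Graph._~_ G) x y → ∀ {u v} → punchIn l u ≡ x → punchIn l v ≡ y →
              Star (Graph._~_ (delete G l)) u v
delete-walk G {l} p ε {u} ux vy with refl ← Fin.punchIn-injective l _ _ (trans ux (sym vy)) = ε
delete-walk G {l} p (_◅_ {j = z} x~z walk) {u} refl vy with punchIn-cases l z
... | inj₂ (w , refl) = x~z ◅ delete-walk G p walk refl vy
... | inj₁ refl with walk
-- The walk ends at a surviving vertex, so it cannot stop at `l`.
...   | ε = contradiction vy (Fin.punchInᵢ≢i l _)
...   | l~z′ ◅ walk′ = delete-walk G p walk′
          (trans (Pendant.only p (~-sym G x~z)) (sym (Pendant.only p l~z′))) vy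

delete-tree : (G : Graph (suc n)) {l s : Fin (suc n)} → Pendant G l s →
              IsTree G → IsTree (delete G l)
delete-tree G {l} p (connected , ¬cycle) =
  (λ u v → delete-walk G p (connected (punchIn l u) (punchIn l v)) refl refl) ,
  _↪_.acyclic (delete-↪ G l) ¬cycle

-- Sequences with footprints

-- A total dominating sequence with a chosen footprint for every vertex, the first one included: a
-- neighbour that no earlier vertex dominates.
record FootprintedSequence (G : Graph n) (k : ℕ) : Set where
  field
    vertex    : Fin k → Fin n
    footprint : Fin k → Fin n
    adjacent  : ∀ i → G ⊢ vertex i ~ footprint i
    fresh     : ∀ {i j} → j Fin.< i → ¬ G ⊢ vertex j ~ footprint i
    dominates : ∀ u → ∃ λ i → G ⊢ u ~ vertex i

  -- An earlier copy of a vertex would already be adjacent to the footprint of the later copy.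
  vertex-injective : ∀ {i j} → vertex i ≡ vertex j → i ≡ j
  vertex-injective {i} {j} eq with Fin.<-cmp i j
  ... | tri≈ _ i≡j _ = i≡j
  ... | tri< i<j _ _ = contradiction (subst (G ⊢_~ footprint j) (sym eq) (adjacent j)) (fresh i<j)
  ... | tri> _ _ j<i = contradiction (subst (G ⊢_~ footprint i) eq (adjacent i)) (fresh j<i)

footprinted⇒TD : {G : Graph n} → FootprintedSequence G k → HasTDSequence G k
footprinted⇒TD {G = G} S = tabulate vertex , (tabulate⁺ vertex-injective , legal) , total
  where
  open FootprintedSequence S
  legal : ∀ i → 0 < toℕ i →
          ∃ λ w → G ⊢ lookup (tabulate vertex) i ~ w ×
                  (∀ j → j Fin.< i → ¬ G ⊢ lookup (tabulate vertex) j ~ w)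
  legal i _ rewrite lookup∘tabulate vertex i =
    footprint i , adjacent i ,
    λ j j<i → fresh j<i ∘ subst (G ⊢_~ _) (lookup∘tabulate vertex j)
  total : TotalDominating G _
  total u with dominates u
  ... | i , u~v = vertex i , ∈-tabulate⁺ vertex i , u~v

-- The new sequence is `l`, then `S`, then `s`. Since `s` is the only neighbour of `l` and lies
-- outside the image, opening with `l` spoils no footprint of `S`; for the same reason no vertex
-- before the last dominates `l`, which is therefore the footprint of the closing `s`.
extend-sequence : {H : Graph m} {G : Graph n} (e : H ↪ G) {l s : Fin n} → Pendant G l s →
                  ¬ _↪_.Image e l → ¬ _↪_.Image e s →
                  (∀ w → _↪_.Image e w ⊎ (G ⊢ w ~ l ⊎ G ⊢ w ~ s)) →
                  FootprintedSequence H k → FootprintedSequence G (2 + k)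
extend-sequence {k = k} {G = G} e {l} {s} p l∉ s∉ cases S = record
  { vertex    = vertex
  ; footprint = footprint
  ; adjacent  = adjacent
  ; fresh     = λ {i} {j} → fresh i j
  ; dominates = dominates
  }
  where
  open _↪_ e
  open Pendant p
  module S = FootprintedSequence S

  vertex : Fin (2 + k) → Fin _
  vertex zero = l
  -- `view` separates the last position, held by `s`, from the `k` positions of `S`.
  vertex (suc i) with view i
  ... | ‵fromℕ     = s
  ... | ‵inject₁ j = to (S.vertex j)

  footprint : Fin (2 + k) → Fin _
  footprint zero = s
  footprint (suc i) with view i
  ... | ‵fromℕ     = l
  ... | ‵inject₁ j = to (S.footprint j)

  adjacent : ∀ i → G ⊢ vertex i ~ footprint i
  adjacent zero = edge
  adjacent (suc i) with view i
  ... | ‵fromℕ     = ~-sym G edge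
  ... | ‵inject₁ j = preserve (S.adjacent j)

  fresh : ∀ i j → j Fin.< i → ¬ G ⊢ vertex j ~ footprint i
  fresh (suc i) zero _ l~w with view i
  ... | ‵fromℕ     = ~-irrefl G l~w
  ... | ‵inject₁ j = s∉ (_ , only l~w)
  fresh (suc i) (suc j) (s≤s j<i) v~w with view i | view j
  ... | ‵fromℕ | ‵fromℕ      = ℕ.<-irrefl refl j<i
  ... | ‵fromℕ | ‵inject₁ j′ = s∉ (_ , only (~-sym G v~w))
  -- The last position precedes no position of `S`.
  ... | ‵inject₁ i′ | ‵fromℕ =
    ℕ.<-asym j<i (subst₂ _<_ (sym (Fin.toℕ-inject₁ i′)) (sym (Fin.toℕ-fromℕ k)) (Fin.toℕ<n i′))
  ... | ‵inject₁ i′ | ‵inject₁ j′ =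
    S.fresh (subst₂ _<_ (Fin.toℕ-inject₁ j′) (Fin.toℕ-inject₁ i′) j<i) (reflect v~w)

  vertex-last : vertex (suc (fromℕ k)) ≡ s
  vertex-last rewrite view-fromℕ k = refl

  vertex-inner : ∀ j → vertex (suc (inject₁ j)) ≡ to (S.vertex j)
  vertex-inner j rewrite view-inject₁ j = refl

  dominates : ∀ u → ∃ λ i → G ⊢ u ~ vertex i
  dominates w with cases w
  ... | inj₂ (inj₁ w~l) = zero , w~l
  ... | inj₂ (inj₂ w~s) = suc (fromℕ k) , subst (G ⊢ w ~_) (sym vertex-last) w~s
  ... | inj₁ (u , refl) with S.dominates u
  ...   | j , u~v = suc (inject₁ j) , subst (G ⊢ to u ~_) (sym (vertex-inner j)) (preserve u~v)

-- Finding a pendant path of length two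

-- A path with `k` edges, hence `k + 1` vertices. Indexing by natural numbers keeps prepending
-- simple; the values of `vertex` beyond `k` are arbitrary.
record Path (G : Graph n) (k : ℕ) : Set where
  field
    vertex    : ℕ → Fin n
    step      : ∀ {i} → i < k → G ⊢ vertex i ~ vertex (suc i)
    injective : ∀ {i j} → i ≤ k → j ≤ k → vertex i ≡ vertex j → i ≡ j

  length<order : k < n
  length<order = Fin.injective⇒≤ {f = vertex ∘ toℕ} λ {i} {j} eq →
    Fin.toℕ-injective (injective (ℕ.≤-pred (Fin.toℕ<n i)) (ℕ.≤-pred (Fin.toℕ<n j)) eq)

  -- If `w` were the path vertex at position `2 + t`, the edge back to position `0` would close a
  -- cycle on the first `3 + t` vertices.
  avoids : ¬ Cycle G → ∀ {w} → G ⊢ w ~ vertex 0 → w ≢ vertex 1 → ∀ {j} → j ≤ k → w ≢ vertex j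
  avoids ¬cycle w~ w≢ {zero}        j≤k = ~⇒≢ G w~
  avoids ¬cycle w~ w≢ {suc zero}    j≤k = w≢
  avoids ¬cycle w~ w≢ {suc (suc t)} j≤k refl = ¬cycle record
    { vertex    = vertex ∘ toℕ
    ; injective = λ {i} {j} eq → Fin.toℕ-injective (injective (bounded i) (bounded j) eq)
    ; step      = λ i → subst (λ h → G ⊢ vertex h ~ vertex (suc (toℕ i)))
                          (sym (Fin.toℕ-inject₁ i)) (step (ℕ.≤-trans (Fin.toℕ<n i) j≤k))
    ; closing   = subst (λ h → G ⊢ vertex h ~ vertex 0) (sym (Fin.toℕ-fromℕ (2 + t))) w~
    }
    where
    bounded : (i : Fin (3 + t)) → toℕ i ≤ k
    bounded i = ℕ.≤-trans (ℕ.≤-pred (Fin.toℕ<n i)) j≤k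

edge-path : (G : Graph n) {u v : Fin n} → G ⊢ u ~ v → Path G 1
edge-path G {u} {v} u~v = record
  { vertex    = vertex
  ; step      = λ { {zero} _ → u~v ; {suc _} (s≤s ()) }
  ; injective = injective
  }
  where
  vertex : ℕ → Fin _
  vertex zero    = u
  vertex (suc _) = v
  injective : ∀ {i j} → i ≤ 1 → j ≤ 1 → vertex i ≡ vertex j → i ≡ j
  injective {zero}        {zero}        _ _ _  = refl
  injective {zero}        {suc _}       _ _ eq = contradiction eq (~⇒≢ G u~v)
  injective {suc _}       {zero}        _ _ eq = contradiction (sym eq) (~⇒≢ G u~v)
  injective {suc zero}    {suc zero}    _ _ _  = refl
  injective {suc (suc _)} (s≤s ())
  injective {suc zero}    {suc (suc _)} _ (s≤s ())

prepend : (G : Graph n) (P : Path G k) {w : Fin n} → G ⊢ w ~ Path.vertex P 0 →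
          (∀ {j} → j ≤ k → w ≢ Path.vertex P j) → Path G (suc k)
prepend {k = k} G P {w} w~ w∉ = record
  { vertex    = vertex
  ; step      = λ { {zero} _ → w~ ; {suc i} (s≤s i<k) → P.step i<k }
  ; injective = injective
  }
  where
  module P = Path P
  vertex : ℕ → Fin _
  vertex zero    = w
  vertex (suc i) = P.vertex i
  injective : ∀ {i j} → i ≤ suc k → j ≤ suc k → vertex i ≡ vertex j → i ≡ j
  injective {zero}  {zero}  _ _ _  = refl
  injective {zero}  {suc _} _ (s≤s j≤k) eq = contradiction eq (w∉ j≤k)
  injective {suc _} {zero}  (s≤s i≤k) _ eq = contradiction (sym eq) (w∉ i≤k)
  injective {suc _} {suc _} (s≤s i≤k) (s≤s j≤k) eq = cong suc (P.injective i≤k j≤k eq)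

-- The end `l`, `s`, `x` of a path at which `s` has degree two: `l≢x` makes its two neighbours
-- distinct and `s-only` excludes a third.
record PendantPath (G : Graph n) : Set where
  field
    {l s x} : Fin n
    l-s     : Pendant G l s
    s~x     : G ⊢ s ~ x
    l≢x     : l ≢ x
    s-only  : ∀ {w} → G ⊢ s ~ w → w ≡ l ⊎ w ≡ x

-- The path grows at vertex 0.  It stops when every neighbour of vertex 0 other
-- than vertex 1 is a leaf; then there is exactly one of them.
search : (G : Graph n) → ¬ Cycle G → NoStrongSupport G → ∀ fuel k → n ≤ fuel + k →
         (P : Path G (suc k)) →
         (∃ λ w → G ⊢ Path.vertex P 0 ~ w × w ≢ Path.vertex P 1) → PendantPath G
-- Without fuel the order is at most `k`, yet the path has `k + 2` distinct vertices.
search G ¬cycle nss zero k n≤k P _ =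
  contradiction (ℕ.<-trans (ℕ.n<1+n k) (Path.length<order P)) (ℕ.≤⇒≯ n≤k)
search {n} G ¬cycle nss (suc fuel) k n≤ P (l , h~l , l≢u)
  with any? (λ w → T? (Graph.adj G (Path.vertex P 0) w) ×-dec
                   (¬? (w Fin.≟ Path.vertex P 1) ×-dec ¬? (leaf? G w)))
... | yes (w , h~w , w≢u , ¬leaf) =
  search G ¬cycle nss fuel (suc k) (ℕ.≤-trans n≤ (ℕ.≤-reflexive (sym (ℕ.+-suc fuel k))))
    (prepend G P (~-sym G h~w) (Path.avoids P ¬cycle (~-sym G h~w) w≢u))
    -- The new end is not a leaf, so it has a neighbour off the path's first edge, as the next round
    -- requires.
    (¬leaf⇒second-neighbor G (~-sym G h~w) ¬leaf)
... | no ¬found = record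
  { l-s    = hanging h~l l≢u
  ; s~x    = Path.step P (s≤s z≤n)
  ; l≢x    = l≢u
  ; s-only = s-only
  }
  where
  hanging : ∀ {w} → G ⊢ Path.vertex P 0 ~ w → w ≢ Path.vertex P 1 →
            Pendant G w (Path.vertex P 0)
  hanging {w} h~w w≢u with leaf? G w
  ... | yes leaf = leaf-pendant G leaf (~-sym G h~w)
  ... | no ¬leaf = contradiction (w , h~w , w≢u , ¬leaf) ¬found
  s-only : ∀ {w} → G ⊢ Path.vertex P 0 ~ w → w ≡ l ⊎ w ≡ Path.vertex P 1
  s-only {w} h~w with w Fin.≟ Path.vertex P 1
  ... | yes w≡u = inj₂ w≡u
  ... | no  w≢u = inj₁ (twin-leaves G nss (hanging h~w w≢u) (hanging h~l l≢u))

-- The first step of the walk that leaves `P`; connectedness is turned into edges by choosing `P`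
-- suitably.
leaving-edge : (G : Graph n) {P : Fin n → Set} → Decidable P → ∀ {u v} → Star (Graph._~_ G) u v →
               P u → ¬ P v → ∃₂ λ a b → P a × ¬ P b × G ⊢ a ~ b
leaving-edge G P? ε pu ¬pv = contradiction pu ¬pv
leaving-edge G P? {u} (_◅_ {j = w} u~w walk) pu ¬pv with P? w
... | yes pw = leaving-edge G P? walk pw ¬pv
... | no ¬pw = u , w , pu , ¬pw , u~w

neighbor : (G : Graph (2 + n)) → Connected G → ∀ v → ∃ λ u → G ⊢ v ~ u
neighbor G connected v
  with leaving-edge G (Fin._≟ v) (connected v (punchIn v zero)) refl (Fin.punchInᵢ≢i v zero)
... | _ , u , refl , _ , v~u = u , v~u

-- Vertex `0` has a neighbour `u`, and some third vertex `c` exists. An edge leaving the pair on the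
-- way to `c` starts at `0` or `u`, which then has the other vertex of the pair as a second
-- neighbour.
vertex-of-degree-≥2 : (G : Graph (3 + n)) → Connected G →
                      ∃ λ h → ∃₂ λ u w → G ⊢ h ~ u × G ⊢ h ~ w × w ≢ u
vertex-of-degree-≥2 G connected with neighbor G connected zero
... | u , 0~u with third
  where
  third : ∃ λ c → ¬ (c ≡ zero ⊎ c ≡ u)
  third with u Fin.≟ suc zero
  ... | yes refl = suc (suc zero) , λ { (inj₁ ()) ; (inj₂ ()) }
  ... | no u≢1   = suc zero , λ { (inj₁ ()) ; (inj₂ 1≡u) → u≢1 (sym 1≡u) }
... | c , c∉ with leaving-edge G (λ w → (w Fin.≟ zero) ⊎-dec (w Fin.≟ u))
                   (connected zero c) (inj₁ refl) c∉
... | _ , w , inj₁ refl , w∉ , h~w = _ , u , w , 0~u , h~w , w∉ ∘ inj₂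
... | _ , w , inj₂ refl , w∉ , h~w = _ , zero , w , ~-sym G 0~u , h~w , w∉ ∘ inj₁

pendant-path : (G : Graph (3 + n)) → IsTree G → NoStrongSupport G → PendantPath G
pendant-path {n} G (connected , ¬cycle) nss with vertex-of-degree-≥2 G connected
... | h , u , w , h~u , h~w , w≢u =
  search G ¬cycle nss (3 + n) 0 (ℕ.m≤m+n _ 0) (edge-path G h~u) (w , h~w , w≢u)

-- Vertex covers and the upper bound on 𝒯

-- The cover is listed by `member`, possibly with repetitions, so `m` bounds its size from above.
record VertexCover (G : Graph n) (m : ℕ) : Set where
  field
    member : Fin m → Fin n

  Member : Fin n → Set
  Member v = ∃ λ a → member a ≡ v

  field
    covers : ∀ {u v} → G ⊢ u ~ v → Member u ⊎ Member v

-- Every position is sent to a cover element lying on the edge from its vertex to its footprint,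
-- tagged by which of the two ends it is. Within each tag this is injective.
TD-length≤ : {G : Graph n} → VertexCover G m → HasTDSequence G k → k ≤ m + m
TD-length≤ {m = m} {k = k} {G = G} C (S , (unique , legal) , total) =
  Fin.injective⇒≤ {f = join m m ∘ side} λ {i} {j} eq → side-injective i j
    (trans (sym (Fin.splitAt-join m m _)) (trans (cong (splitAt m) eq) (Fin.splitAt-join m m _)))
  where
  open VertexCover C

  footprinted : ∀ i → ∃ λ w → G ⊢ lookup S i ~ w × (∀ j → j Fin.< i → ¬ G ⊢ lookup S j ~ w)
  -- `Legal` exempts the first vertex; total domination gives it a neighbour, and nothing comes
  -- earlier.
  footprinted zero with total (lookup S zero)
  ... | w , _ , v~w = w , v~w , λ _ ()
  footprinted (suc i) = legal (suc i) (s≤s z≤n)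

  footprint : Fin k → Fin _
  footprint i = proj₁ (footprinted i)

  adjacent : ∀ i → G ⊢ lookup S i ~ footprint i
  adjacent i = proj₁ (proj₂ (footprinted i))

  footprint-injective : ∀ {i j} → footprint i ≡ footprint j → i ≡ j
  footprint-injective {i} {j} eq with Fin.<-cmp i j
  ... | tri≈ _ i≡j _ = i≡j
  ... | tri< i<j _ _ =
    contradiction (subst (G ⊢ lookup S i ~_) eq (adjacent i)) (proj₂ (proj₂ (footprinted j)) i i<j)
  ... | tri> _ _ j<i =
    contradiction (subst (G ⊢ lookup S j ~_) (sym eq) (adjacent j)) (proj₂ (proj₂ (footprinted i)) j j<i)

  covered : ∀ i → Member (lookup S i) ⊎ Member (footprint i)
  covered i = covers (adjacent i)

  side : Fin k → Fin m ⊎ Fin m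
  side = Sum.map proj₁ proj₁ ∘ covered

  side-injective : ∀ i j → side i ≡ side j → i ≡ j
  side-injective i j eq with covered i | covered j
  side-injective i j refl | inj₁ (a , p) | inj₁ (_ , q) =
    lookup-injective unique i j (trans (sym p) q)
  side-injective i j refl | inj₂ (a , p) | inj₂ (_ , q) =
    footprint-injective (trans (sym p) q)

-- The exception s ≢ v, l ≡ v only occurs for P₂, where both vertices are
-- support vertices but a cover of the right size has a single element.
record TightCover (G : Graph n) (v : Fin n) : Set where
  field
    {size}   : ℕ
    size-≡   : 3 * size ≡ n + 1
    cover    : VertexCover G size
  open VertexCover cover public
  field
    member-v : Member v
    supports : ∀ {l s} → Pendant G l s → Member s ⊎ l ≡ v

-- Operation `𝒪₁` may act at any support vertex, so the induction carries a tight cover through each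
-- of them; `l-s` guarantees that there is one.
record TightCovers (G : Graph n) : Set where
  field
    {l s}  : Fin n
    l-s    : Pendant G l s
    covers : ∀ {l v} → Pendant G l v → TightCover G v

path₂-covers : TightCovers P₂
path₂-covers = record
  { l = zero
  ; l-s    = pendant _ λ { {zero} () ; {suc zero} _ → refl }
  ; covers = λ {_} {v} _ → record
    { size-≡   = refl
    ; cover    = record { member = λ _ → v ; covers = λ {a} {b} → covers v {a} {b} }
    ; member-v = zero , refl
    ; supports = λ {l} {s} p → supports v {l} {s} (Pendant.edge p)
    }
  }
  where
  Member : Fin 2 → Fin 2 → Set
  Member v a = ∃ λ (_ : Fin 1) → v ≡ a
  covers : ∀ v {a b} → P₂ ⊢ a ~ b → Member v a ⊎ Member v b
  covers zero       {zero}             _ = inj₁ (zero , refl)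
  covers zero       {suc zero} {zero}  _ = inj₂ (zero , refl)
  covers zero       {suc zero} {suc zero} ()
  covers (suc zero) {suc zero}         _ = inj₁ (zero , refl)
  covers (suc zero) {zero} {suc zero}  _ = inj₂ (zero , refl)
  covers (suc zero) {zero} {zero} ()
  supports : ∀ v {l s} → P₂ ⊢ l ~ s → Member v s ⊎ l ≡ v
  supports v {l} {s} l~s with covers v {s} {l} (~-sym P₂ {l} {s} l~s)
  ... | inj₁ found      = inj₁ found
  ... | inj₂ (_ , refl) = inj₂ refl

-- Adding `v₂` to a tight cover through `v` suffices: `v₂` covers both edges of the new path and `v`
-- covers the joining edge. One cover element is added for three vertices, and the same cover
-- contains every support vertex of the new graph.
attachP₃-covers : {G : Graph n} {v u : Fin n} → Pendant G u v → TightCovers G →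
                  TightCovers (attachP₃ G v)
attachP₃-covers {n} {G} {v} {u} u-v C = record
  { l-s    = pendant {l = v₃} {s = v₂} _ λ { {v₂} _ → refl }
  ; covers = new
  }
  where
  module K = TightCover (TightCovers.covers C u-v)
  G⁺ = attachP₃ G v

  member⁺ : Fin (suc K.size) → Fin (3 + n)
  member⁺ zero    = v₂
  member⁺ (suc a) = old (K.member a)

  Member⁺ : Fin (3 + n) → Set
  Member⁺ w = ∃ λ a → member⁺ a ≡ w

  lift : ∀ {w} → K.Member w → Member⁺ (old w)
  lift (a , refl) = suc a , refl

  covers⁺ : ∀ {a b} → G⁺ ⊢ a ~ b → Member⁺ a ⊎ Member⁺ b
  covers⁺ {v₂}            _ = inj₁ (zero , refl)
  covers⁺ {b = v₂}        _ = inj₂ (zero , refl)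
  covers⁺ {v₁} {old b}    e with refl ← does⇒ (b Fin.≟ v) e = inj₂ (lift K.member-v)
  covers⁺ {old a} {v₁}    e with refl ← does⇒ (a Fin.≟ v) e = inj₁ (lift K.member-v)
  covers⁺ {old a} {old b} e = Sum.map lift lift (K.covers e)

  v₁~v : G⁺ ⊢ v₁ ~ old v
  v₁~v = ⇒does (v Fin.≟ v) refl

  -- Both `v₁` and `u` are neighbours of `v`. This disposes of the exception `l ≡ v` in
  -- `TightCover`.
  v∉leaves : ∀ {s} → ¬ Pendant G⁺ (old v) s
  v∉leaves p with trans (Pendant.only p {v₁} v₁~v)
                        (sym (Pendant.only p {old u} (~-sym G (Pendant.edge u-v))))
  ... | ()

  supports⁺ : ∀ {l s} → Pendant G⁺ l s → Member⁺ s
  supports⁺ {v₁} p with trans (Pendant.only p {v₂} _) (sym (Pendant.only p {old v} v₁~v))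
  ... | ()
  supports⁺ {v₂} p with trans (Pendant.only p {v₁} _) (sym (Pendant.only p {v₃} _))
  ... | ()
  supports⁺ {v₃} {v₂} p = zero , refl
  supports⁺ {v₃} {v₁} (pendant () _)
  supports⁺ {v₃} {v₃} (pendant () _)
  supports⁺ {v₃} {old _} (pendant () _)
  supports⁺ {old l} {v₂} _ = zero , refl
  supports⁺ {old l} {v₃} (pendant () _)
  supports⁺ {old l} {v₁} p with refl ← does⇒ (l Fin.≟ v) (Pendant.edge p) =
    contradiction p v∉leaves
  supports⁺ {old l} {old s} p
    with K.supports (pendant (Pendant.edge p) λ {w} e → old-injective (Pendant.only p {old w} e))
    where
    old-injective : ∀ {a b : Fin n} → _≡_ {A = Fin (3 + n)} (old a) (old b) → a ≡ b
    old-injective refl = refl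
  ... | inj₁ found = lift found
  ... | inj₂ refl  = contradiction p v∉leaves

  new : ∀ {l w} → Pendant G⁺ l w → TightCover G⁺ w
  new p = record
    { size-≡   = trans (ℕ.*-suc 3 K.size) (cong (3 +_) K.size-≡)
    ; cover    = record { member = member⁺ ; covers = λ {a} {b} → covers⁺ {a} {b} }
    ; member-v = supports⁺ p
    ; supports = inj₁ ∘ supports⁺
    }

-- Transport of covers along isomorphisms

module Iso {G : Graph m} {H : Graph n} (G≅H : G ≅ H) where
  open _≅_ G≅H
  open Inverse bijection public using (to; from; strictlyInverseˡ; strictlyInverseʳ)

  to-~ : ∀ {u v} → G ⊢ u ~ v → H ⊢ to u ~ to v
  to-~ {u} {v} = subst T (adj-≡ u v)

  to-~⁻¹ : ∀ {u v} → H ⊢ to u ~ to v → G ⊢ u ~ v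
  to-~⁻¹ {u} {v} = subst T (sym (adj-≡ u v))

  from-~ : ∀ {u v} → H ⊢ u ~ v → G ⊢ from u ~ from v
  from-~ {u} {v} =
    to-~⁻¹ ∘ subst₂ (H ⊢_~_) (sym (strictlyInverseˡ u)) (sym (strictlyInverseˡ v))

  to-pendant : ∀ {l s} → Pendant G l s → Pendant H (to l) (to s)
  to-pendant {l} (pendant e o) = pendant (to-~ e) λ {w} l~w →
    trans (sym (strictlyInverseˡ w))
          (cong to (o (subst (G ⊢_~ from w) (strictlyInverseʳ l) (from-~ l~w))))

  from-pendant : ∀ {l s} → Pendant H l s → Pendant G (from l) (from s)
  from-pendant {l} (pendant e o) = pendant (from-~ e) λ {w} l~w →
    trans (sym (strictlyInverseʳ w))
          (cong from (o (subst (H ⊢_~ to w) (strictlyInverseˡ l) (to-~ l~w))))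

iso-covers : {G : Graph m} {H : Graph n} → G ≅ H → TightCovers G → TightCovers H
iso-covers {m} {n} {G} {H} G≅H C = record
  { l-s    = to-pendant (TightCovers.l-s C)
  ; covers = transported
  }
  where
  open Iso G≅H
  transported : ∀ {l v} → Pendant H l v → TightCover H v
  transported {v = v} p = record
    { size-≡   = trans K.size-≡ (cong (_+ 1) (↔⇒≡ (_≅_.bijection G≅H)))
    ; cover    = record
      { member = to ∘ K.member
      ; covers = λ e → Sum.map push push (K.covers (from-~ e))
      }
    ; member-v = push K.member-v
    ; supports = λ p → Sum.map push from-injective (K.supports (from-pendant p))
    }
    where
    module K = TightCover (TightCovers.covers C (from-pendant p))
    push : ∀ {w} → K.Member (from w) → ∃ λ a → to (K.member a) ≡ w
    push {w} (a , eq) = a , trans (cong to eq) (strictlyInverseˡ w)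
    from-injective : ∀ {a b} → from a ≡ from b → a ≡ b
    from-injective {a} {b} eq =
      trans (sym (strictlyInverseˡ a)) (trans (cong to eq) (strictlyInverseˡ b))

𝒯-covers : {G : Graph n} → 𝒯 G → TightCovers G
𝒯-covers path₂ = path₂-covers
𝒯-covers (𝒪₁ {T′ = T′} t (l , v~l , leaf)) =
  attachP₃-covers (leaf-pendant T′ leaf (~-sym T′ v~l)) (𝒯-covers t)
𝒯-covers (iso G≅H t) = iso-covers G≅H (𝒯-covers t)

𝒯-upper-bound : {G : Graph n} → 𝒯 G → HasTDSequence G k → 3 * k ≤ 2 * (n + 1)
𝒯-upper-bound {n} {k} t s = begin
  3 * k               ≤⟨ ℕ.*-monoʳ-≤ 3 (TD-length≤ K.cover s) ⟩
  3 * (K.size + K.size) ≡⟨ regroup K.size ⟩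
  2 * (3 * K.size)    ≡⟨ cong (2 *_) K.size-≡ ⟩
  2 * (n + 1)         ∎
  where
  open ℕ.≤-Reasoning
  module C = TightCovers (𝒯-covers t)
  module K = TightCover (C.covers C.l-s)
  regroup : ∀ a → 3 * (a + a) ≡ 2 * (3 * a)
  regroup = solve-∀

-- The lower bound

-- The graph H is G without a leaf l and its neighbour s of degree two.
record Peeling (G : Graph (2 + n)) (π : PendantPath G) : Set where
  open PendantPath π
  field
    H        : Graph n
    tree     : IsTree H
    embed    : H ↪ G
  open _↪_ embed public
  field
    {x₀}     : Fin n
    to-x₀    : to x₀ ≡ x
    l∉       : ¬ Image l
    s∉       : ¬ Image s
    cases    : ∀ w → w ≡ l ⊎ w ≡ s ⊎ Image w

  -- Among the vertices of `H` only `x₀` is adjacent to `l` or `s`, so every other vertex keeps its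
  -- neighbourhood.
  lift-pendant : ∀ {a b} → a ≢ x₀ → Pendant H a b → Pendant G (to a) (to b)
  lift-pendant {a} a≢x₀ = pendant-extend inside
    where
    inside : ∀ {w} → G ⊢ to a ~ w → Image w
    inside {w} a~w with cases w
    ... | inj₂ (inj₂ w∈) = w∈
    ... | inj₁ refl = contradiction (a , Pendant.only l-s (~-sym G a~w)) s∉
    ... | inj₂ (inj₁ refl) with s-only (~-sym G a~w)
    ...   | inj₁ a≡l = contradiction (a , a≡l) l∉
    ...   | inj₂ a≡x = contradiction (injective (trans a≡x (sym to-x₀))) a≢x₀

  x-cases : ∀ {w} → G ⊢ x ~ w → w ≡ s ⊎ ∃ λ u → to u ≡ w × H ⊢ x₀ ~ u
  x-cases {w} x~w with cases w
  ... | inj₁ refl = contradiction (Pendant.only l-s (~-sym G x~w)) (~⇒≢ G s~x ∘ sym)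
  ... | inj₂ (inj₁ w≡s) = inj₁ w≡s
  ... | inj₂ (inj₂ (u , refl)) = inj₂ (u , refl , reflect (subst (G ⊢_~ to u) (sym to-x₀) x~w))

-- Once `l` is deleted, `s` is a leaf at `x`; both deletions thus remove leaves and preserve trees.
peel : (G : Graph (2 + n)) → IsTree G → (π : PendantPath G) → Peeling G π
peel G tree record { l = l ; s = s ; x = x ; l-s = l-s ; s~x = s~x ; l≢x = l≢x ; s-only = s-only }
  with punchIn-cases l s | punchIn-cases l x
... | inj₁ refl | _         = contradiction (Pendant.edge l-s) (~-irrefl G)
... | inj₂ _    | inj₁ refl = contradiction refl l≢x
... | inj₂ (s₁ , refl) | inj₂ (x₁ , refl) with punchIn-cases s₁ x₁
...   | inj₁ refl = contradiction s~x (~-irrefl G)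
...   | inj₂ (x₂ , refl) = record
  { tree  = delete-tree G₁ s₁-x₁ (delete-tree G l-s tree)
  ; embed = delete-↪ G l ∘↪ delete-↪ G₁ s₁
  ; to-x₀ = refl
  ; l∉    = λ (_ , eq) → Fin.punchInᵢ≢i l _ eq
  ; s∉    = λ (_ , eq) → Fin.punchInᵢ≢i s₁ _ (Fin.punchIn-injective l _ _ eq)
  ; cases = cases
  }
  where
  G₁ = delete G l

  s₁-x₁ : Pendant G₁ s₁ (punchIn s₁ x₂)
  s₁-x₁ = pendant s~x only
    where
    only : ∀ {w} → G₁ ⊢ s₁ ~ w → w ≡ punchIn s₁ x₂
    only s₁~w with s-only s₁~w
    ... | inj₁ eq = contradiction eq (Fin.punchInᵢ≢i l _)
    ... | inj₂ eq = Fin.punchIn-injective l _ _ eq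

  cases : ∀ w → w ≡ l ⊎ w ≡ punchIn l s₁ ⊎ ∃ λ u → punchIn l (punchIn s₁ u) ≡ w
  cases w with punchIn-cases l w
  ... | inj₁ w≡l = inj₁ w≡l
  ... | inj₂ (w₁ , refl) with punchIn-cases s₁ w₁
  ...   | inj₁ refl       = inj₂ (inj₁ refl)
  ...   | inj₂ (u , refl) = inj₂ (inj₂ (u , refl))

-- The vertices `x`, `s`, `l` play the roles of `v₁`, `v₂`, `v₃`; their prescribed neighbourhoods
-- determine every edge outside `H`.
attachP₃-≅ : {H : Graph m} {G : Graph (3 + m)} (e : H ↪ G) {x s l : Fin (3 + m)} {y : Fin m} →
             let open _↪_ e in
             ¬ Image x → ¬ Image s → ¬ Image l →
             (∀ w → w ≡ x ⊎ w ≡ s ⊎ w ≡ l ⊎ Image w) →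
             Pendant G l s → G ⊢ s ~ x → (∀ {w} → G ⊢ s ~ w → w ≡ l ⊎ w ≡ x) →
             G ⊢ x ~ to y → (∀ {w} → G ⊢ x ~ w → w ≡ s ⊎ w ≡ to y) → l ≢ x →
             attachP₃ H y ≅ G
attachP₃-≅ {m} {H} {G} e {x} {s} {l} {y} x∉ s∉ l∉ cases l-s s~x s-only x~y x-only l≢x = record
  { bijection = mk↔ₛ′ φ ψ φψ ψφ
  ; adj-≡     = adj-≡′
  }
  where
  open _↪_ e
  A = attachP₃ H y

  φ : Fin (3 + m) → Fin (3 + m)
  φ v₁      = x
  φ v₂      = s
  φ v₃      = l
  φ (old u) = to u

  preimage : ∀ w → ∃ λ a → φ a ≡ w
  preimage w with cases w
  ... | inj₁ refl                     = v₁ , refl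
  ... | inj₂ (inj₁ refl)              = v₂ , refl
  ... | inj₂ (inj₂ (inj₁ refl))       = v₃ , refl
  ... | inj₂ (inj₂ (inj₂ (u , to-u))) = old u , to-u

  ψ : Fin (3 + m) → Fin (3 + m)
  ψ = proj₁ ∘ preimage

  φψ : ∀ w → φ (ψ w) ≡ w
  φψ = proj₂ ∘ preimage

  s≢x : s ≢ x
  s≢x = ~⇒≢ G s~x

  l≢s : l ≢ s
  l≢s = ~⇒≢ G (Pendant.edge l-s)

  φ-injective : ∀ a b → φ a ≡ φ b → a ≡ b
  φ-injective v₁      v₁      _  = refl
  φ-injective v₁      v₂      eq = contradiction (sym eq) s≢x
  φ-injective v₁      v₃      eq = contradiction (sym eq) l≢x
  φ-injective v₁      (old b) eq = contradiction (b , sym eq) x∉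
  φ-injective v₂      v₁      eq = contradiction eq s≢x
  φ-injective v₂      v₂      _  = refl
  φ-injective v₂      v₃      eq = contradiction (sym eq) l≢s
  φ-injective v₂      (old b) eq = contradiction (b , sym eq) s∉
  φ-injective v₃      v₁      eq = contradiction eq l≢x
  φ-injective v₃      v₂      eq = contradiction eq l≢s
  φ-injective v₃      v₃      _  = refl
  φ-injective v₃      (old b) eq = contradiction (b , sym eq) l∉
  φ-injective (old a) v₁      eq = contradiction (a , eq) x∉
  φ-injective (old a) v₂      eq = contradiction (a , eq) s∉
  φ-injective (old a) v₃      eq = contradiction (a , eq) l∉
  φ-injective (old a) (old b) eq = cong (λ u → old u) (injective eq)

  ψφ : ∀ a → ψ (φ a) ≡ a
  -- A right inverse of an injective map is also a left inverse.
  ψφ a = φ-injective _ _ (φψ (φ a))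

  nonadjacent : ∀ {u v} → ¬ G ⊢ u ~ v → false ≡ Graph.adj G u v
  nonadjacent u≁v = T-ext (λ ()) u≁v

  l≁ : ∀ {w} → w ≢ s → ¬ G ⊢ l ~ w
  l≁ w≢s = w≢s ∘ Pendant.only l-s

  s≁old : ∀ u → ¬ G ⊢ s ~ to u
  s≁old u s~u with s-only s~u
  ... | inj₁ eq = l∉ (u , eq)
  ... | inj₂ eq = x∉ (u , eq)

  x-old : ∀ u → does (u Fin.≟ y) ≡ Graph.adj G x (to u)
  x-old u = T-ext forth back
    where
    forth : T (does (u Fin.≟ y)) → G ⊢ x ~ to u
    forth t with refl ← does⇒ (u Fin.≟ y) t = x~y
    back : G ⊢ x ~ to u → T (does (u Fin.≟ y))
    back x~u with x-only x~u
    ... | inj₁ eq = contradiction (u , eq) s∉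
    ... | inj₂ eq = ⇒does (u Fin.≟ y) (injective eq)

  flip : ∀ a b → Graph.adj A b a ≡ Graph.adj G (φ b) (φ a) →
         Graph.adj A a b ≡ Graph.adj G (φ a) (φ b)
  flip a b eq = trans (Graph.sym A a b) (trans eq (Graph.sym G (φ b) (φ a)))

  adj-≡′ : ∀ a b → Graph.adj A a b ≡ Graph.adj G (φ a) (φ b)
  adj-≡′ v₁      v₁      = nonadjacent (~-irrefl G)
  adj-≡′ v₁      v₂      = T-ext (λ _ → ~-sym G s~x) _
  adj-≡′ v₁      v₃      = nonadjacent (l≁ (s≢x ∘ sym) ∘ ~-sym G)
  adj-≡′ v₁      (old u) = x-old u
  adj-≡′ v₂      v₁      = flip v₂ v₁ (adj-≡′ v₁ v₂)
  adj-≡′ v₂      v₂      = nonadjacent (~-irrefl G)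
  adj-≡′ v₂      v₃      = T-ext (λ _ → ~-sym G (Pendant.edge l-s)) _
  adj-≡′ v₂      (old u) = nonadjacent (s≁old u)
  adj-≡′ v₃      v₁      = flip v₃ v₁ (adj-≡′ v₁ v₃)
  adj-≡′ v₃      v₂      = flip v₃ v₂ (adj-≡′ v₂ v₃)
  adj-≡′ v₃      v₃      = nonadjacent (~-irrefl G)
  adj-≡′ v₃      (old u) = nonadjacent (l≁ λ eq → s∉ (u , eq))
  adj-≡′ (old u) v₁      = flip (old u) v₁ (adj-≡′ v₁ (old u))
  adj-≡′ (old u) v₂      = flip (old u) v₂ (adj-≡′ v₂ (old u))
  adj-≡′ (old u) v₃      = flip (old u) v₃ (adj-≡′ v₃ (old u))
  adj-≡′ (old u) (old w) = adj-≡ u w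

-- The induction hypothesis couples the bound with extremality: a sequence that is not strictly long
-- enough comes with membership in `𝒯`.
Bound : Graph n → Set
Bound {n} G = ∃ λ k → FootprintedSequence G k ×
              (3 * k > 2 * (n + 1) ⊎ (3 * k ≡ 2 * (n + 1) × 𝒯 G))

Bounds : ℕ → Set
Bounds n = 2 ≤ n → (G : Graph n) → IsTree G → NoStrongSupport G → Bound G

bounds-2 : Bounds 2
bounds-2 _ G (connected , _) _ = 2 , S , inj₂ (refl , iso P₂≅G path₂)
  where
  0~1 : G ⊢ zero ~ suc zero
  0~1 with neighbor G connected zero
  ... | zero     , 0~0 = contradiction 0~0 (~-irrefl G)
  ... | suc zero , 0~1 = 0~1

  other : Fin 2 → Fin 2
  other zero       = suc zero
  other (suc zero) = zero

  adjacent : ∀ i → G ⊢ i ~ other i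
  adjacent zero       = 0~1
  adjacent (suc zero) = ~-sym G 0~1

  fresh : ∀ i j → j Fin.< i → ¬ G ⊢ j ~ other i
  fresh (suc zero) zero       _ = ~-irrefl G
  fresh (suc zero) (suc zero) (s≤s ())

  S : FootprintedSequence G 2
  S = record
    { vertex    = id
    ; footprint = other
    ; adjacent  = adjacent
    ; fresh     = λ {i} {j} → fresh i j
    ; dominates = λ u → other u , adjacent u
    }

  adj-≡ : ∀ u v → Graph.adj P₂ u v ≡ Graph.adj G u v
  adj-≡ zero       zero       = sym (Graph.irrefl G zero)
  adj-≡ zero       (suc zero) = T-ext (λ _ → 0~1) _
  adj-≡ (suc zero) zero       = T-ext (λ _ → ~-sym G 0~1) _
  adj-≡ (suc zero) (suc zero) = sym (Graph.irrefl G (suc zero))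

  P₂≅G : P₂ ≅ G
  P₂≅G = record { bijection = mk↔ₛ′ id id (λ _ → refl) (λ _ → refl) ; adj-≡ = adj-≡ }

distinct⇒2≤ : {u v : Fin n} → u ≢ v → 2 ≤ n
distinct⇒2≤ {suc zero} {zero} {zero} u≢v = contradiction refl u≢v
distinct⇒2≤ {suc (suc _)} _ = s≤s (s≤s z≤n)

-- Strong support in the peeled graph H can only arise because x became a leaf.
module _ {G : Graph (2 + n)} (nss : NoStrongSupport G) (π : PendantPath G) (peeling : Peeling G π)
  where
  open PendantPath π
  open Peeling peeling

  strong-support-at-x₀ : ∀ {y} → StrongSupport H y →
                         Pendant H x₀ y × ∃ λ q → q ≢ x₀ × Pendant H q y
  strong-support-at-x₀ {y} (p , q , p≢q , (y~p , leaf-p) , (y~q , leaf-q))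
    with leaf-pendant H leaf-p (~-sym H y~p) | leaf-pendant H leaf-q (~-sym H y~q)
       | p Fin.≟ x₀ | q Fin.≟ x₀
  ... | p-y | q-y | yes refl | _        = p-y , q , p≢q ∘ sym , q-y
  ... | p-y | q-y | no p≢x₀  | yes refl = q-y , p , p≢q , p-y
  -- Two leaves other than `x₀` would already share a support vertex in `G`.
  ... | p-y | q-y | no p≢x₀  | no q≢x₀  =
    contradiction (injective (twin-leaves G nss (lift-pendant p≢x₀ p-y) (lift-pendant q≢x₀ q-y))) p≢q

  extend-peeled : FootprintedSequence H k → FootprintedSequence G (2 + k)
  extend-peeled = extend-sequence embed l-s l∉ s∉ λ w → dominated (cases w)
    where
    dominated : ∀ {w} → w ≡ l ⊎ w ≡ s ⊎ Image w → Image w ⊎ (G ⊢ w ~ l ⊎ G ⊢ w ~ s)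
    dominated (inj₁ refl)        = inj₂ (inj₂ (Pendant.edge l-s))
    dominated (inj₂ (inj₁ refl)) = inj₂ (inj₁ (~-sym G (Pendant.edge l-s)))
    dominated (inj₂ (inj₂ w∈))   = inj₁ w∈

  -- Two more vertices raise `2 * (n + 1)` by four, while two more sequence entries raise `3 * k` by
  -- six; the result is strict even if `H` attains equality.
  bound-peeled : Bound H → Bound G
  bound-peeled (k , S , b) = 2 + k , extend-peeled S , inj₁ (begin-strict
    2 * ((2 + n) + 1)  ≡⟨ order n ⟩
    4 + 2 * (n + 1)    ≤⟨ ℕ.+-monoʳ-≤ 4 ([ ℕ.<⇒≤ , ℕ.≤-reflexive ∘ sym ∘ proj₁ ]′ b) ⟩
    4 + 3 * k          <⟨ ℕ.+-monoˡ-< (3 * k) {4} {6} (s≤s (s≤s (s≤s (s≤s (s≤s z≤n))))) ⟩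
    6 + 3 * k          ≡⟨ length k ⟩
    3 * (2 + k)        ∎)
    where
    open ℕ.≤-Reasoning
    order : ∀ n → 2 * ((2 + n) + 1) ≡ 4 + 2 * (n + 1)
    order = solve-∀
    length : ∀ k → 6 + 3 * k ≡ 3 * (2 + k)
    length = solve-∀

module _ {G : Graph (3 + n)} (nss : NoStrongSupport G) (π : PendantPath G) (peeling : Peeling G π)
  where
  open PendantPath π
  open Peeling peeling

  -- With `x` removed along with `l` and `s`, the leaf `q` keeps `y` a support vertex, so `G` arises
  -- by `𝒪₁` at `y`. Three vertices and two sequence entries raise the two sides by six each, which
  -- preserves strictness as well as equality.
  bound-detached : Bounds n → ∀ {y q} → Pendant H x₀ y → q ≢ x₀ → Pendant H q y → Bound G
  bound-detached bounds {y} {q} x₀-y q≢x₀ q-y with punchIn-cases x₀ y | punchIn-cases x₀ q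
  ... | inj₁ refl | _         = contradiction (Pendant.edge x₀-y) (~-irrefl H)
  ... | inj₂ _    | inj₁ refl = contradiction refl q≢x₀
  ... | inj₂ (y₁ , refl) | inj₂ (q₁ , refl) =
    conclude (bounds (distinct⇒2≤ q₁≢y₁) D (delete-tree H x₀-y tree) nss-D)
    where
    D = delete H x₀
    e = embed ∘↪ delete-↪ H x₀
    module E = _↪_ e

    q₁≢y₁ : q₁ ≢ y₁
    q₁≢y₁ refl = ~-irrefl H (Pendant.edge q-y)

    q-y-in-G : Pendant G (E.to q₁) (E.to y₁)
    q-y-in-G = lift-pendant q≢x₀ q-y

    -- Deleting the leaf `x₀` of `H` takes a neighbour from `y₁` alone.
    lift : ∀ {a b} → a ≢ y₁ → Pendant D a b → Pendant G (E.to a) (E.to b)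
    lift {a} a≢y₁ = lift-pendant (Fin.punchInᵢ≢i x₀ a) ∘
                    _↪_.pendant-extend (delete-↪ H x₀) inside
      where
      inside : ∀ {w} → H ⊢ punchIn x₀ a ~ w → ∃ λ u → punchIn x₀ u ≡ w
      inside {w} a~w with punchIn-cases x₀ w
      ... | inj₂ w∈   = w∈
      ... | inj₁ refl = contradiction
        (Fin.punchIn-injective x₀ _ _ (Pendant.only x₀-y (~-sym H a~w))) a≢y₁

    -- If y becomes a leaf, its only neighbour left is the leaf q.
    y₁-alone : ∀ {z a} → Pendant D y₁ z → Pendant D a z → a ≡ y₁
    y₁-alone y₁-z a-z
      with refl ← Pendant.only y₁-z (~-sym D (E.reflect (Pendant.edge q-y-in-G))) =
      E.injective (Pendant.only q-y-in-G (E.preserve (~-sym D (Pendant.edge a-z))))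

    nss-D : NoStrongSupport D
    nss-D z (a , b , a≢b , (z~a , leaf-a) , (z~b , leaf-b))
      with leaf-pendant D leaf-a (~-sym D z~a) | leaf-pendant D leaf-b (~-sym D z~b)
         | a Fin.≟ y₁ | b Fin.≟ y₁
    ... | a-z | b-z | yes refl | _       = a≢b (sym (y₁-alone a-z b-z))
    ... | a-z | b-z | no _     | yes refl = a≢b (y₁-alone b-z a-z)
    ... | a-z | b-z | no a≢y₁  | no b≢y₁ =
      a≢b (E.injective (twin-leaves G nss (lift a≢y₁ a-z) (lift b≢y₁ b-z)))

    x∉ : ¬ E.Image x
    x∉ (u , eq) = Fin.punchInᵢ≢i x₀ u (injective (trans eq (sym to-x₀)))

    s∉E : ¬ E.Image s
    s∉E (_ , eq) = s∉ (_ , eq)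

    l∉E : ¬ E.Image l
    l∉E (_ , eq) = l∉ (_ , eq)

    casesE : ∀ w → w ≡ x ⊎ w ≡ s ⊎ w ≡ l ⊎ E.Image w
    casesE w with cases w
    ... | inj₁ w≡l        = inj₂ (inj₂ (inj₁ w≡l))
    ... | inj₂ (inj₁ w≡s) = inj₂ (inj₁ w≡s)
    ... | inj₂ (inj₂ (u , refl)) with punchIn-cases x₀ u
    ...   | inj₁ refl       = inj₁ to-x₀
    ...   | inj₂ (v , refl) = inj₂ (inj₂ (inj₂ (v , refl)))

    x-only : ∀ {w} → G ⊢ x ~ w → w ≡ s ⊎ w ≡ E.to y₁
    x-only x~w with x-cases x~w
    ... | inj₁ w≡s = inj₁ w≡s
    ... | inj₂ (_ , refl , x₀~u) = inj₂ (cong to (Pendant.only x₀-y x₀~u))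

    x~y : G ⊢ x ~ E.to y₁
    x~y = subst (G ⊢_~ E.to y₁) to-x₀ (preserve (Pendant.edge x₀-y))

    attached : attachP₃ D y₁ ≅ G
    attached = attachP₃-≅ e x∉ s∉E l∉E casesE l-s s~x s-only x~y x-only l≢x

    y₁-support : Support D y₁
    y₁-support = q₁ , ~-sym D (Pendant.edge q₁-y₁) , pendant⇒leaf D q₁-y₁
      where q₁-y₁ = E.pendant-restrict q-y-in-G

    extend-detached : FootprintedSequence D k → FootprintedSequence G (2 + k)
    extend-detached = extend-sequence e l-s l∉E s∉E λ w → dominated (casesE w)
      where
      dominated : ∀ {w} → w ≡ x ⊎ w ≡ s ⊎ w ≡ l ⊎ E.Image w →
                  E.Image w ⊎ (G ⊢ w ~ l ⊎ G ⊢ w ~ s)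
      dominated (inj₁ refl)               = inj₂ (inj₂ (~-sym G s~x))
      dominated (inj₂ (inj₁ refl))        = inj₂ (inj₁ (~-sym G (Pendant.edge l-s)))
      dominated (inj₂ (inj₂ (inj₁ refl))) = inj₂ (inj₂ (Pendant.edge l-s))
      dominated (inj₂ (inj₂ (inj₂ w∈)))   = inj₁ w∈

    order : ∀ n → 2 * ((3 + n) + 1) ≡ 6 + 2 * (n + 1)
    order = solve-∀

    length : ∀ k → 3 * (2 + k) ≡ 6 + 3 * k
    length = solve-∀

    conclude : Bound D → Bound G
    conclude (k , S , inj₁ gt) = 2 + k , extend-detached S ,
      inj₁ (subst₂ _<_ (sym (order n)) (sym (length k)) (ℕ.+-monoʳ-< 6 gt))
    conclude (k , S , inj₂ (eq , t)) = 2 + k , extend-detached S ,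
      inj₂ (trans (length k) (trans (cong (6 +_) eq) (sym (order n))) ,
            iso attached (𝒪₁ t y₁-support))

-- Peeling lowers the order by two and detaching by three, so two earlier orders enter.
bounds-step : Bounds (1 + n) → Bounds n → Bounds (3 + n)
bounds-step {n} b₁ b₀ _ G tree nss = by-cases b₁ b₀ nss π (peel G tree π)
  where
  π : PendantPath G
  π = pendant-path G tree nss
  by-cases : ∀ {n} {G : Graph (3 + n)} → Bounds (1 + n) → Bounds n → NoStrongSupport G →
             (π : PendantPath G) → Peeling G π → Bound G
  -- At order three `H` is a single vertex, so `x` is a second leaf at `s`.
  by-cases {zero} {G} _ _ nss π peeling = contradiction (twin-leaves G nss l-s x-s) l≢x
    where
    open PendantPath π
    open Peeling peeling
    no-edge : ∀ {u v : Fin 1} → ¬ H ⊢ u ~ v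
    no-edge {zero} {zero} = ~-irrefl H
    x-s : Pendant G x s
    x-s = pendant (~-sym G s~x) λ x~w →
      [ id , (λ (_ , _ , x₀~u) → contradiction x₀~u no-edge) ]′ (x-cases x~w)
  by-cases {suc n} b₁ b₀ nss π peeling with any? (strongSupport? (Peeling.H peeling))
  ... | no none = bound-peeled nss π peeling
                    (b₁ (s≤s (s≤s z≤n)) (Peeling.H peeling) (Peeling.tree peeling)
                        λ v ss → none (v , ss))
  ... | yes (y , ss) with strong-support-at-x₀ nss π peeling ss
  ...   | x₀-y , q , q≢x₀ , q-y = bound-detached nss π peeling b₀ x₀-y q≢x₀ q-y

bounds : ∀ n → Bounds n
bounds zero                ()
bounds (suc zero)          (s≤s ())
bounds (suc (suc zero))    = bounds-2
bounds (suc (suc (suc n))) = bounds-step (bounds (suc n)) (bounds n)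

-- The bound and its extremal trees

mainTheorem11 : ∀ (n : ℕ) → 2 ≤ n → (T : Graph n) → IsTree T →
    (∀ (v : Fin n) → ¬ StrongSupport T v) →
    (3 * γgrᵗ T ≥ 2 * (n + 1)) × ((3 * γgrᵗ T ≡ 2 * (n + 1)) ⇔ 𝒯 T)
mainTheorem11 n 2≤n T tree nss with bounds n 2≤n T tree nss
... | k , S , bound = lower , mk⇔ extremal (λ t → ℕ.≤-antisym (upper t) lower)
  where
  k≤γ : 3 * k ≤ 3 * γgrᵗ T
  k≤γ = ℕ.*-monoʳ-≤ 3 (γgrᵗ-maximum T (footprinted⇒TD S))

  lower : 3 * γgrᵗ T ≥ 2 * (n + 1)
  lower = ℕ.≤-trans ([ ℕ.<⇒≤ , ℕ.≤-reflexive ∘ sym ∘ proj₁ ]′ bound) k≤γ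

  upper : 𝒯 T → 3 * γgrᵗ T ≤ 2 * (n + 1)
  upper t = 𝒯-upper-bound t (γgrᵗ-attained T (footprinted⇒TD S))

  extremal : 3 * γgrᵗ T ≡ 2 * (n + 1) → 𝒯 T
  -- As `k` is at most the maximum length, equality there rules out the strict alternative and
  -- leaves membership in `𝒯`.
  extremal eq = [ (λ gt → contradiction (subst (3 * k ≤_) eq k≤γ) (ℕ.<⇒≱ gt)) , proj₂ ]′ bound
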